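{- Let $G$ be a group with subgroups $H$ and $N$ satisfying $HN = G$ and $H \cap N = 1$. (a) If $N$ is a normal subgroup of $G$, then there exists a homomorphism $\varphi \colon H \to \mathrm{Aut}(N)$ such that $G \cong N \rtimes_\varphi H$. (b) Moreover, if $H$ and $N$ are both normal subgroups of $G$, then $G \cong H \times N$.
   Context: The group $G$ is not assumed finite. $HN = \{hn : h \in H,\ n \in N\}$, and $1$ denotes the trivial subgroup. For groups $N$ and $H$ and a homomorphism $\varphi \colon H \to \mathrm{Aut}(N)$, the semidirect product $N \rtimes_\varphi H$ is the set $N \times H$ with multiplication $(n_1,h_1)(n_2,h_2) = (n_1\,\varphi(h_1)(n_2),\, h_1h_2)$. -}

module Defs where

open import Algebra.Bundles using (Group)
open import Algebra.Bundles.Raw using (RawGroup)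
open import Algebra.Morphism.Bundles using (GroupHomomorphism)
open import Algebra.Morphism.Structures using (IsGroupMonomorphism; IsGroupIsomorphism)
import Algebra.Morphism.Construct.Composition as Composition
import Algebra.Morphism.Construct.Identity as Identity
import Algebra.Morphism.GroupMonomorphism as GroupMonomorphism
open import Data.Product.Base using (Σ; _×_; _,_; proj₁; proj₂; ∃₂)
open import Data.Product.Relation.Binary.Pointwise.NonDependent using (Pointwise; ×-isEquivalence)
open import Function.Base using (id; _∘_; _on_)
open import Level using (Level; _⊔_; suc)
open import Relation.Binary.Definitions using (_Respects_)
import Relation.Binary.Reasoning.Setoid as ≈-Reasoning
open import Relation.Unary using (Pred; _∈_)

private
  variable
    a b c ℓ ℓ₁ ℓ₂ p q : Level

-- Groups are setoid-based, so a subgroup is a predicate that has to be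
-- invariant under the equality _≈_ of the ambient group.
record Subgroup (G : Group c ℓ) (p : Level) : Set (c ⊔ ℓ ⊔ suc p) where
  open Group G
  field
    Member    : Pred Carrier p
    resp      : Member Respects _≈_
    ε-closed  : ε ∈ Member
    ∙-closed  : ∀ {x y} → x ∈ Member → y ∈ Member → (x ∙ y) ∈ Member
    ⁻¹-closed : ∀ {x} → x ∈ Member → (x ⁻¹) ∈ Member

open Subgroup public using (Member)

-- Elements of a subgroup are equal when they are equal in G, whatever the
-- proofs of membership.
module _ {G : Group c ℓ} (H : Subgroup G p) where
  private
    module G = Group G
    module H = Subgroup H

    rawSubgroup : RawGroup (c ⊔ p) ℓ
    rawSubgroup = record
      { Carrier = Σ G.Carrier H.Member
      ; _≈_     = G._≈_ on proj₁
      ; _∙_     = λ { (x , x∈H) (y , y∈H) → x G.∙ y , H.∙-closed x∈H y∈H }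
      ; ε       = G.ε , H.ε-closed
      ; _⁻¹     = λ { (x , x∈H) → x G.⁻¹ , H.⁻¹-closed x∈H }
      }

    inclusion : IsGroupMonomorphism rawSubgroup G.rawGroup proj₁
    inclusion = record
      { isGroupHomomorphism = record
        { isMonoidHomomorphism = record
          { isMagmaHomomorphism = record
            { isRelHomomorphism = record { cong = id }
            ; homo              = λ _ _ → G.refl
            }
          ; ε-homo = G.refl
          }
        ; ⁻¹-homo = λ _ → G.refl
        }
      ; injective = id
      }

  subgroupGroup : Group (c ⊔ p) ℓ
  subgroupGroup = record
    { RawGroup rawSubgroup
    ; isGroup = GroupMonomorphism.isGroup inclusion G.isGroup
    }

Normal : {G : Group c ℓ} → Subgroup G p → Set (c ⊔ p)
Normal {G = G} N = ∀ g {n} → n ∈ Member N → (g ∙ n ∙ g ⁻¹) ∈ Member N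
  where open Group G

module _ (G : Group c ℓ) where
  open Group G

  productSet : Pred Carrier p → Pred Carrier q → Pred Carrier (c ⊔ ℓ ⊔ p ⊔ q)
  productSet A B g = ∃₂ λ x y → x ∈ A × y ∈ B × g ≈ x ∙ y

  trivialSet : Pred Carrier ℓ
  trivialSet g = g ≈ ε

infix 4 _≅_

record _≅_ (G : Group a ℓ₁) (K : Group b ℓ₂) : Set (a ⊔ b ⊔ ℓ₁ ⊔ ℓ₂) where
  private
    module G = Group G
    module K = Group K
  field
    to                 : G.Carrier → K.Carrier
    isGroupIsomorphism : IsGroupIsomorphism G.rawGroup K.rawGroup to

  open IsGroupIsomorphism isGroupIsomorphism public

module _ {G : Group a ℓ₁} {K : Group b ℓ₂} (f : G ≅ K) where
  private
    module G = Group G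
    module K = Group K
    module f = _≅_ f

  from : K.Carrier → G.Carrier
  from y = proj₁ (f.surjective y)

  to∘from : ∀ y → f.to (from y) K.≈ y
  to∘from y = proj₂ (f.surjective y) G.refl

  from∘to : ∀ x → from (f.to x) G.≈ x
  from∘to x = f.injective (to∘from (f.to x))

  from-cong : ∀ {x y} → x K.≈ y → from x G.≈ from y
  from-cong {x} {y} x≈y =
    f.injective (K.trans (to∘from x) (K.trans x≈y (K.sym (to∘from y))))

  ≅-sym : K ≅ G
  ≅-sym = record
    { to = from
    ; isGroupIsomorphism = record
      { isGroupMonomorphism = record
        { isGroupHomomorphism = record
          { isMonoidHomomorphism = record
            { isMagmaHomomorphism = record
              { isRelHomomorphism = record { cong = from-cong }
              ; homo = λ x y → f.injective
                  (K.trans (to∘from (x K.∙ y))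
                    (K.sym (K.trans (f.∙-homo (from x) (from y))
                                    (K.∙-cong (to∘from x) (to∘from y)))))
              }
            ; ε-homo = f.injective (K.trans (to∘from K.ε) (K.sym f.ε-homo))
            }
          ; ⁻¹-homo = λ x → f.injective
              (K.trans (to∘from (x K.⁻¹))
                (K.sym (K.trans (f.⁻¹-homo (from x)) (K.⁻¹-cong (to∘from x)))))
          }
        ; injective = λ {x} {y} eq →
            K.trans (K.sym (to∘from x)) (K.trans (f.⟦⟧-cong eq) (to∘from y))
        }
      ; surjective = λ x → f.to x , λ z≈fx → G.trans (from-cong z≈fx) (from∘to x)
      }
    }

-- Automorphisms are compared pointwise, and the product is composition:
-- (f ∙ g)(x) = f (g x).
Aut : Group a ℓ → Group (a ⊔ ℓ) (a ⊔ ℓ)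
Aut N = record
  { Carrier = N ≅ N
  ; _≈_     = λ f g → ∀ x → to f x N.≈ to g x
  ; _∙_     = λ f g → record
    { to = to f ∘ to g
    ; isGroupIsomorphism = Composition.isGroupIsomorphism N.trans
        (isGroupIsomorphism g) (isGroupIsomorphism f)
    }
  ; ε       = record
    { to = id
    ; isGroupIsomorphism = Identity.isGroupIsomorphism N.rawGroup N.refl
    }
  ; _⁻¹     = ≅-sym
  ; isGroup = record
    { isMonoid = record
      { isSemigroup = record
        { isMagma = record
          { isEquivalence = record
            { refl  = λ _ → N.refl
            ; sym   = λ f≈g x → N.sym (f≈g x)
            ; trans = λ f≈g g≈h x → N.trans (f≈g x) (g≈h x)
            }
          ; ∙-cong = λ {f} {f′} {g} {g′} f≈f′ g≈g′ x →
              N.trans (⟦⟧-cong f (g≈g′ x)) (f≈f′ (to g′ x))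
          }
        ; assoc = λ _ _ _ _ → N.refl
        }
      ; identity = (λ _ _ → N.refl) , (λ _ _ → N.refl)
      }
    ; inverse = from∘to , to∘from
    ; ⁻¹-cong = λ {f} {g} f≈g x → injective f
        (N.trans (to∘from f x)
          (N.sym (N.trans (f≈g (from g x)) (to∘from g x))))
    }
  }
  where
  module N = Group N
  open _≅_

Action : Group a ℓ₁ → Group b ℓ₂ → Set (a ⊔ b ⊔ ℓ₁ ⊔ ℓ₂)
Action H N = GroupHomomorphism (Group.rawGroup H) (Group.rawGroup (Aut N))

SemidirectProduct : (N : Group a ℓ₁) (H : Group b ℓ₂) → Action H N →
                    Group (a ⊔ b) (ℓ₁ ⊔ ℓ₂)
SemidirectProduct N H φ = record
  { Carrier = N.Carrier × H.Carrier
  ; _≈_     = Pointwise N._≈_ H._≈_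
  ; _∙_     = λ { (n₁ , h₁) (n₂ , h₂) → n₁ N.∙ act h₁ n₂ , h₁ H.∙ h₂ }
  ; ε       = N.ε , H.ε
  ; _⁻¹     = λ { (n , h) → act (h H.⁻¹) (n N.⁻¹) , h H.⁻¹ }
  ; isGroup = record
    { isMonoid = record
      { isSemigroup = record
        { isMagma = record
          { isEquivalence = ×-isEquivalence N.isEquivalence H.isEquivalence
          ; ∙-cong = λ { (n₁≈ , h₁≈) (n₂≈ , h₂≈) →
              N.∙-cong n₁≈ (act-cong h₁≈ n₂≈) , H.∙-cong h₁≈ h₂≈ }
          }
        ; assoc = λ { (n₁ , h₁) (n₂ , h₂) (n₃ , h₃) →
            assocᴺ n₁ n₂ n₃ h₁ h₂ , H.assoc h₁ h₂ h₃ }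
        }
      ; identity =
          (λ { (n , h) → N.trans (N.identityˡ _) (φ.ε-homo n) , H.identityˡ h })
        , (λ { (n , h) →
            N.trans (N.∙-congˡ (ε-homo (φ.⟦ h ⟧))) (N.identityʳ n) , H.identityʳ h })
      }
    ; inverse =
        (λ { (n , h) → inverseˡᴺ n h , H.inverseˡ h })
      , (λ { (n , h) → inverseʳᴺ n h , H.inverseʳ h })
    ; ⁻¹-cong = λ { (n≈ , h≈) →
        act-cong (H.⁻¹-cong h≈) (N.⁻¹-cong n≈) , H.⁻¹-cong h≈ }
    }
  }
  where
  module N = Group N
  module H = Group H
  module φ = GroupHomomorphism φ
  open _≅_
  open ≈-Reasoning N.setoid

  act : H.Carrier → N.Carrier → N.Carrier
  act h = to (φ.⟦ h ⟧)

  act-cong : ∀ {h h′ n n′} → h H.≈ h′ → n N.≈ n′ → act h n N.≈ act h′ n′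
  act-cong {h} {n′ = n′} h≈ n≈ = N.trans (⟦⟧-cong (φ.⟦ h ⟧) n≈) (φ.⟦⟧-cong h≈ n′)

  assocᴺ : ∀ n₁ n₂ n₃ h₁ h₂ →
           (n₁ N.∙ act h₁ n₂) N.∙ act (h₁ H.∙ h₂) n₃ N.≈ n₁ N.∙ act h₁ (n₂ N.∙ act h₂ n₃)
  assocᴺ n₁ n₂ n₃ h₁ h₂ = begin
    (n₁ N.∙ act h₁ n₂) N.∙ act (h₁ H.∙ h₂) n₃   ≈⟨ N.∙-congˡ (φ.homo h₁ h₂ n₃) ⟩
    (n₁ N.∙ act h₁ n₂) N.∙ act h₁ (act h₂ n₃)   ≈⟨ N.assoc _ _ _ ⟩
    n₁ N.∙ (act h₁ n₂ N.∙ act h₁ (act h₂ n₃))   ≈⟨ N.∙-congˡ (∙-homo (φ.⟦ h₁ ⟧) _ _) ⟨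
    n₁ N.∙ act h₁ (n₂ N.∙ act h₂ n₃)            ∎

  inverseˡᴺ : ∀ n h → act (h H.⁻¹) (n N.⁻¹) N.∙ act (h H.⁻¹) n N.≈ N.ε
  inverseˡᴺ n h = begin
    act (h H.⁻¹) (n N.⁻¹) N.∙ act (h H.⁻¹) n    ≈⟨ ∙-homo (φ.⟦ h H.⁻¹ ⟧) _ _ ⟨
    act (h H.⁻¹) (n N.⁻¹ N.∙ n)                 ≈⟨ ⟦⟧-cong (φ.⟦ h H.⁻¹ ⟧) (N.inverseˡ n) ⟩
    act (h H.⁻¹) N.ε                            ≈⟨ ε-homo (φ.⟦ h H.⁻¹ ⟧) ⟩
    N.ε                                         ∎

  inverseʳᴺ : ∀ n h → n N.∙ act h (act (h H.⁻¹) (n N.⁻¹)) N.≈ N.ε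
  inverseʳᴺ n h = begin
    n N.∙ act h (act (h H.⁻¹) (n N.⁻¹))         ≈⟨ N.∙-congˡ (φ.homo h (h H.⁻¹) _) ⟨
    n N.∙ act (h H.∙ h H.⁻¹) (n N.⁻¹)           ≈⟨ N.∙-congˡ (φ.⟦⟧-cong (H.inverseʳ h) _) ⟩
    n N.∙ act H.ε (n N.⁻¹)                      ≈⟨ N.∙-congˡ (φ.ε-homo _) ⟩
    n N.∙ n N.⁻¹                                ≈⟨ N.inverseʳ n ⟩
    N.ε                                         ∎

{-# OPTIONS --safe #-}
-- If N is normal, H acts on N by conjugation, and h n = (h n h⁻¹) h turns HN = G
-- into NH = G, so (n , h) ↦ n h is a surjective homomorphism from N ⋊ H to G.
-- Its kernel is trivial, because n h = 1 puts n = h⁻¹ into H ∩ N = 1.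
-- If H is normal too, every commutator of n and h lies in H ∩ N = 1, hence H and N
-- commute elementwise and (h , n) ↦ h n is an isomorphism from H × N to G for the
-- same reasons.
module Submission where

open import Defs
open import Algebra.Bundles using (Group)
open import Algebra.Construct.DirectProduct renaming (group to directProduct) using ()
open import Algebra.Morphism.Structures using (IsGroupHomomorphism)
import Algebra.Properties.Group as GroupProperties
import Algebra.Properties.Semigroup as SemigroupProperties
open import Data.Product using (_×_; Σ-syntax; _,_; proj₁; proj₂; ∃)
open import Level using (Level)
import Relation.Binary.Reasoning.Setoid as ≈-Reasoning
open import Relation.Unary using (_≐_; _∩_; U; _∈_)

private
  variable
    a b c ℓ ℓ₁ ℓ₂ p q : Level

module _ (K : Group a ℓ₁) (G : Group b ℓ₂)
         (f : Group.Carrier K → Group.Carrier G)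
         where
  private
    module K where
      open Group K public
      open GroupProperties K public
    module G where
      open Group G public
      open GroupProperties G public

  module _ (f-cong : ∀ {x y} → x K.≈ y → f x G.≈ f y)
           (f-homo : ∀ x y → f (x K.∙ y) G.≈ f x G.∙ f y)
           where

    -- Multiplicativity suffices between groups: `f ε` is idempotent, hence trivial, and then
    -- `f (x ⁻¹)` is a left inverse of `f x`.
    isGroupHomomorphism : IsGroupHomomorphism K.rawGroup G.rawGroup f
    isGroupHomomorphism = record
      { isMonoidHomomorphism = record
        { isMagmaHomomorphism = record
          { isRelHomomorphism = record { cong = f-cong }
          ; homo              = f-homo
          }
        ; ε-homo = ε-homo
        }
      ; ⁻¹-homo = λ x → G.inverseˡ-unique _ _
          (G.trans (G.sym (f-homo _ _)) (G.trans (f-cong (K.inverseˡ x)) ε-homo))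
      }
      where
      ε-homo : f K.ε G.≈ G.ε
      ε-homo = G.identityˡ-unique _ _
        (G.trans (G.sym (f-homo _ _)) (f-cong (K.identityˡ K.ε)))

    -- If `f x` and `f y` agree, then `x ∙ y ⁻¹` is in the kernel. Every isomorphism below,
    -- including each conjugation automorphism of `N`, is obtained from this criterion.
    trivialKernel∧surjective⇒≅ : (∀ x → f x G.≈ G.ε → x K.≈ K.ε) →
                                 (∀ y → ∃ λ x → f x G.≈ y) →
                                 K ≅ G
    trivialKernel∧surjective⇒≅ trivialKernel surjective = record
      { to                 = f
      ; isGroupIsomorphism = record
        { isGroupMonomorphism = record
          { isGroupHomomorphism = isGroupHomomorphism
          ; injective           = injective
          }
        ; surjective = λ y → proj₁ (surjective y) ,
            λ z≈x → G.trans (f-cong z≈x) (proj₂ (surjective y))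
        }
      }
      where
      open ≈-Reasoning G.setoid
      module f = IsGroupHomomorphism isGroupHomomorphism

      injective : ∀ {x y} → f x G.≈ f y → x K.≈ y
      injective {x} {y} fx≈fy = K.x∙y⁻¹≈ε⇒x≈y x y (trivialKernel _ (begin
        f (x K.∙ y K.⁻¹)      ≈⟨ f-homo x (y K.⁻¹) ⟩
        f x G.∙ f (y K.⁻¹)    ≈⟨ G.∙-congˡ (f.⁻¹-homo y) ⟩
        f x G.∙ f y G.⁻¹      ≈⟨ G.x≈y⇒x∙y⁻¹≈ε fx≈fy ⟩
        G.ε                   ∎))

module Conjugation (G : Group c ℓ) where
  open Group G
  open GroupProperties G
  open SemigroupProperties semigroup
  open ≈-Reasoning setoid

  conj : Carrier → Carrier → Carrier
  conj g x = g ∙ x ∙ g ⁻¹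

  conj-cong : ∀ {g h x y} → g ≈ h → x ≈ y → conj g x ≈ conj h y
  conj-cong g≈h x≈y = ∙-cong (∙-cong g≈h x≈y) (⁻¹-cong g≈h)

  conj-homo : ∀ g x y → conj g (x ∙ y) ≈ conj g x ∙ conj g y
  conj-homo g x y = begin
    g ∙ (x ∙ y) ∙ g ⁻¹                 ≈⟨ [u∙vw]x≈uv∙wx g x y (g ⁻¹) ⟩
    -- The factor `g ⁻¹ ∙ g` is inserted between `x` and `y`.
    g ∙ x ∙ (y ∙ g ⁻¹)                 ≈⟨ ∙-congʳ (//-rightDividesˡ g (g ∙ x)) ⟨
    conj g x ∙ g ∙ (y ∙ g ⁻¹)          ≈⟨ uv∙wx≈u[vw∙x] (conj g x) g y (g ⁻¹) ⟩
    conj g x ∙ conj g y                ∎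

  conj-∙ : ∀ g h x → conj (g ∙ h) x ≈ conj g (conj h x)
  conj-∙ g h x = begin
    g ∙ h ∙ x ∙ (g ∙ h) ⁻¹             ≈⟨ ∙-congˡ (⁻¹-anti-homo-∙ g h) ⟩
    g ∙ h ∙ x ∙ (h ⁻¹ ∙ g ⁻¹)          ≈⟨ assoc _ _ _ ⟨
    g ∙ h ∙ x ∙ h ⁻¹ ∙ g ⁻¹            ≈⟨ ∙-congʳ ([uv∙w]x≈u[vw∙x] g h x (h ⁻¹)) ⟩
    conj g (conj h x)                  ∎

  conj-ε : ∀ x → conj ε x ≈ x
  conj-ε x = trans (∙-cong (identityˡ x) ε⁻¹≈ε) (identityʳ x)

  conj-conj⁻¹ : ∀ g x → conj g (conj (g ⁻¹) x) ≈ x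
  conj-conj⁻¹ g x = begin
    conj g (conj (g ⁻¹) x)             ≈⟨ conj-∙ g (g ⁻¹) x ⟨
    conj (g ∙ g ⁻¹) x                  ≈⟨ conj-cong (inverseʳ g) refl ⟩
    conj ε x                           ≈⟨ conj-ε x ⟩
    x                                  ∎

  -- Moving `g ⁻¹` to the other side leaves `g ∙ x ≈ g`, and `g` cancels.
  conj≈ε⇒≈ε : ∀ g x → conj g x ≈ ε → x ≈ ε
  conj≈ε⇒≈ε g x eq = identityʳ-unique g x (x∙y⁻¹≈ε⇒x≈y (g ∙ x) g eq)

  commutator≈ε⇒commute : ∀ x y → conj x y ∙ y ⁻¹ ≈ ε → x ∙ y ≈ y ∙ x
  commutator≈ε⇒commute x y eq = begin
    x ∙ y                              ≈⟨ //-rightDividesˡ x (x ∙ y) ⟨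
    conj x y ∙ x                       ≈⟨ ∙-congʳ (x∙y⁻¹≈ε⇒x≈y _ _ eq) ⟩
    y ∙ x                              ∎

module _ (G : Group c ℓ) (H : Subgroup G p) (N : Subgroup G q) where
  open Group G
  open GroupProperties G
  open SemigroupProperties semigroup
  open Conjugation G
  open ≈-Reasoning setoid
  private
    module H = Subgroup H
    module N = Subgroup N

  conjugationAction : Normal N → Action (subgroupGroup H) (subgroupGroup N)
  conjugationAction N⊴G = record
    { ⟦_⟧                 = λ (h , _) → automorphism h
    ; isGroupHomomorphism =
        isGroupHomomorphism (subgroupGroup H) (Aut (subgroupGroup N)) _
          (λ h≈h′ _ → conj-cong h≈h′ refl)
          (λ (h , _) (h′ , _) (n , _) → conj-∙ h h′ n)
    }
    where
    -- Normality is used twice: at `g` to keep the image in `N`, and at `g ⁻¹` to keep the preimage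
    -- `conj (g ⁻¹) n` in `N`.
    automorphism : Carrier → subgroupGroup N ≅ subgroupGroup N
    automorphism g = trivialKernel∧surjective⇒≅ (subgroupGroup N) (subgroupGroup N)
      (λ (n , n∈N) → conj g n , N⊴G g n∈N)
      (conj-cong refl)
      (λ (m , _) (n , _) → conj-homo g m n)
      (λ (n , _) → conj≈ε⇒≈ε g n)
      (λ (n , n∈N) → (conj (g ⁻¹) n , N⊴G (g ⁻¹) n∈N) , conj-conj⁻¹ g n)

  module _ (factor  : ∀ g → productSet G (Member H) (Member N) g)
           (trivial : ∀ {x} → x ∈ Member H → x ∈ Member N → x ≈ ε)
           where

    private
      x∙y≈ε⇒x≈ε∧y≈ε : ∀ {x y} → x ∈ Member H → y ∈ Member N → x ∙ y ≈ ε → x ≈ ε × y ≈ ε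
      x∙y≈ε⇒x≈ε∧y≈ε {x} {y} x∈H y∈N xy≈ε = x≈ε , (begin
        y        ≈⟨ identityˡ y ⟨
        ε ∙ y    ≈⟨ ∙-congʳ x≈ε ⟨
        x ∙ y    ≈⟨ xy≈ε ⟩
        ε        ∎)
        where
        x≈ε : x ≈ ε
        -- From `x ∙ y ≈ ε`, `x` is the inverse of `y` and so lies in `N` as well as in `H`.
        x≈ε = trivial x∈H (N.resp (sym (inverseˡ-unique x y xy≈ε)) (N.⁻¹-closed y∈N))

      -- Reconciles the order `n ∙ h` of the semidirect product with the order `h ∙ n` of the
      -- factorization.
      y∙x≈ε⇒x∙y≈ε : ∀ {x y} → y ∙ x ≈ ε → x ∙ y ≈ ε
      y∙x≈ε⇒x∙y≈ε {x} {y} yx≈ε = trans (∙-congˡ (inverseˡ-unique y x yx≈ε)) (inverseʳ x)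

    -- Multiplication out of the product has an explicit formula, so the isomorphism is built in
    -- that direction and then inverted.
    ≅-semidirectProduct : (N⊴G : Normal N) →
      G ≅ SemidirectProduct (subgroupGroup N) (subgroupGroup H) (conjugationAction N⊴G)
    ≅-semidirectProduct N⊴G = ≅-sym (trivialKernel∧surjective⇒≅ _ G
      mul
      (λ (n≈n′ , h≈h′) → ∙-cong n≈n′ h≈h′)
      homo trivialKernel surjective)
      where
      NH = SemidirectProduct (subgroupGroup N) (subgroupGroup H) (conjugationAction N⊴G)
      module NH = Group NH

      mul : NH.Carrier → Carrier
      mul ((n , _) , (h , _)) = n ∙ h

      homo : ∀ x y → mul (x NH.∙ y) ≈ mul x ∙ mul y
      homo ((n , _) , (h , _)) ((n′ , _) , (h′ , _)) = begin
        n ∙ conj h n′ ∙ (h ∙ h′)       ≈⟨ uv∙wx≈u[vw∙x] n (conj h n′) h h′ ⟩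
        -- The twist by the action is exactly what moves `h` past `n′`: `conj h n′ ∙ h` collapses to
        -- `h ∙ n′`.
        n ∙ (conj h n′ ∙ h ∙ h′)       ≈⟨ ∙-congˡ (∙-congʳ (//-rightDividesˡ h (h ∙ n′))) ⟩
        n ∙ (h ∙ n′ ∙ h′)              ≈⟨ uv∙wx≈u[vw∙x] n h n′ h′ ⟨
        n ∙ h ∙ (n′ ∙ h′)              ∎

      trivialKernel : ∀ x → mul x ≈ ε → x NH.≈ NH.ε
      trivialKernel ((n , n∈N) , (h , h∈H)) nh≈ε =
        let h≈ε , n≈ε = x∙y≈ε⇒x≈ε∧y≈ε h∈H n∈N (y∙x≈ε⇒x∙y≈ε nh≈ε) in n≈ε , h≈ε

      surjective : ∀ g → ∃ λ x → mul x ≈ g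
      surjective g = let h , n , h∈H , n∈N , g≈hn = factor g in
        -- Rewrites `h ∙ n` as `conj h n ∙ h`, with the factor from `N` first.
        ((conj h n , N⊴G h n∈N) , (h , h∈H)) ,
        trans (//-rightDividesˡ h (h ∙ n)) (sym g≈hn)

    -- The commutator is bracketed in two ways: `x ∙ (y ∙ x ⁻¹ ∙ y ⁻¹)` is a product in `H`, and
    -- `(x ∙ y ∙ x ⁻¹) ∙ y ⁻¹` is a product in `N`.
    normals-commute : Normal H → Normal N →
                      ∀ {x y} → x ∈ Member H → y ∈ Member N → x ∙ y ≈ y ∙ x
    normals-commute H⊴G N⊴G {x} {y} x∈H y∈N = commutator≈ε⇒commute x y (trivial
      (H.resp x∙[yx⁻¹y⁻¹]≈[x,y] (H.∙-closed x∈H (H⊴G y (H.⁻¹-closed x∈H))))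
      (N.∙-closed (N⊴G x y∈N) (N.⁻¹-closed y∈N)))
      where
      x∙[yx⁻¹y⁻¹]≈[x,y] : x ∙ conj y (x ⁻¹) ≈ conj x y ∙ y ⁻¹
      x∙[yx⁻¹y⁻¹]≈[x,y] = sym ([uv∙w]x≈u[vw∙x] x y (x ⁻¹) (y ⁻¹))

    ≅-directProduct : Normal H → Normal N →
                      G ≅ directProduct (subgroupGroup H) (subgroupGroup N)
    ≅-directProduct H⊴G N⊴G = ≅-sym (trivialKernel∧surjective⇒≅ _ G
      mul
      (λ (h≈h′ , n≈n′) → ∙-cong h≈h′ n≈n′)
      homo
      (λ ((h , h∈H) , (n , n∈N)) → x∙y≈ε⇒x≈ε∧y≈ε h∈H n∈N)
      (λ g → let h , n , h∈H , n∈N , g≈hn = factor g in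
        ((h , h∈H) , (n , n∈N)) , sym g≈hn))
      where
      module H×N = Group (directProduct (subgroupGroup H) (subgroupGroup N))

      mul : H×N.Carrier → Carrier
      mul ((h , _) , (n , _)) = h ∙ n

      homo : ∀ x y → mul (x H×N.∙ y) ≈ mul x ∙ mul y
      homo ((h , _) , (n , n∈N)) ((h′ , h′∈H) , (n′ , _)) = begin
        h ∙ h′ ∙ (n ∙ n′)              ≈⟨ uv∙wx≈u[vw∙x] h h′ n n′ ⟩
        -- Only the inner pair `h′`, `n` has to be exchanged.
        h ∙ (h′ ∙ n ∙ n′)              ≈⟨ ∙-congˡ (∙-congʳ (normals-commute H⊴G N⊴G h′∈H n∈N)) ⟩
        h ∙ (n ∙ h′ ∙ n′)              ≈⟨ uv∙wx≈u[vw∙x] h n h′ n′ ⟨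
        h ∙ n ∙ (h′ ∙ n′)              ∎

lemma2p2 : ∀ {c ℓ p q} (G : Group c ℓ) (H : Subgroup G p) (N : Subgroup G q) →
    productSet G (Member H) (Member N) ≐ U →
    Member H ∩ Member N ≐ trivialSet G →
    (Normal N →
    Σ[ φ ∈ Action (subgroupGroup H) (subgroupGroup N) ]
    G ≅ SemidirectProduct (subgroupGroup N) (subgroupGroup H) φ)
    × (Normal H → Normal N →
    G ≅ directProduct (subgroupGroup H) (subgroupGroup N))
lemma2p2 G H N (_ , U⊆HN) (H∩N⊆1 , _) =
    (λ N⊴G → conjugationAction G H N N⊴G , ≅-semidirectProduct G H N factor trivial N⊴G)
  , ≅-directProduct G H N factor trivial
  where
  factor : ∀ g → productSet G (Member H) (Member N) g
  -- The underscore is the trivial proof that `g` belongs to `U`.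
  factor g = U⊆HN {g} _

  trivial : ∀ {x} → x ∈ Member H → x ∈ Member N → trivialSet G x
  trivial x∈H x∈N = H∩N⊆1 (x∈H , x∈N)
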